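{- There exists a function $g:\mathbb{N}\to\mathbb{R}_{>0}$ with $g(n)\to\infty$ as $n\to\infty$ such that the following holds: for every positive integer $n$ and every multi-graph $G$ on $n$ vertices such that every set of edges whose removal makes $G$ triangle-free has size at least $n^2$, the number of triangles in $G$ is at least $g(n)\,n^2$. (That is, such $G$ contains $\omega(n^2)$ triangles.)
   Context: A multi-graph on a finite vertex set $V$ is given by assigning to each unordered pair $\{u,v\}$ of distinct vertices a nonnegative integer multiplicity $m(u,v)$, the number of (parallel) edges joining $u$ and $v$; there are no loops, and multiplicities may be arbitrarily large. Triangles are identified with their edge sets: a triangle consists of three distinct vertices $u,v,w$ together with a choice of one edge between each of the pairs $\{u,v\},\{v,w\},\{u,w\}$. Thus the number of triangles of $G$ is $\sum_{\{u,v,w\}} m(u,v)\,m(v,w)\,m(u,w)$, the sum over all 3-element subsets of $V$. Removing edges means deleting individual parallel edges (each deleted edge counts once); $G$ is triangle-free if it contains no triangle. -}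

module Defs where

open import Data.Bool.Base using (if_then_else_; _∧_)
open import Data.Fin.Base using (Fin; _<_)
open import Data.Fin.Properties using (_<?_; <-trans)
open import Data.Integer.Base using (+_)
open import Data.List.Base using (List; []; _∷_; length)
open import Data.List.Membership.Propositional using (_∉_)
open import Data.List.Relation.Unary.All using (All)
open import Data.List.Relation.Unary.Unique.Propositional using (Unique)
open import Data.Nat.Base as ℕ using (ℕ)
open import Data.Nat.Properties using (+-0-commutativeMonoid)
open import Data.Product.Base using (∃-syntax)
open import Data.Rational.Base as ℚ using (ℚ; _/_)
open import Relation.Binary.PropositionalEquality using (_≡_)
open import Relation.Nullary.Decidable.Core using (⌊_⌋)
open import Relation.Nullary.Negation using (¬_)

open import Algebra.Properties.CommutativeMonoid.Sum +-0-commutativeMonoid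
  using (sum-syntax)

record MultiGraph (n : ℕ) : Set where
  field
    mult      : Fin n → Fin n → ℕ
    symmetric : ∀ u v → mult u v ≡ mult v u
    loopless  : ∀ v → mult v v ≡ 0

open MultiGraph public

-- An unordered pair of distinct vertices is represented by its increasing
-- ordering.  The ordering proof is irrelevant, so two edges are equal exactly
-- when they have the same end points and are the same parallel copy.
record Edge {n : ℕ} (G : MultiGraph n) : Set where
  constructor edge
  field
    u v  : Fin n
    .u<v : u < v
    copy : Fin (mult G u v)

record Triangle {n : ℕ} (G : MultiGraph n) : Set where
  constructor triangle
  field
    u v w : Fin n
    u<v   : u < v
    v<w   : v < w
    uv    : Fin (mult G u v)
    vw    : Fin (mult G v w)
    uw    : Fin (mult G u w)

  edges : List (Edge G)
  edges = edge u v u<v uv ∷ edge v w v<w vw ∷ edge u w (<-trans u<v v<w) uw ∷ []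

open Triangle public using (edges)

numTriangles : ∀ {n} → MultiGraph n → ℕ
numTriangles {n} G =
  ∑[ u < n ] ∑[ v < n ] ∑[ w < n ]
    (if ⌊ u <? v ⌋ ∧ ⌊ v <? w ⌋
     then mult G u v ℕ.* mult G v w ℕ.* mult G u w
     else 0)

record EdgeSet {n : ℕ} (G : MultiGraph n) : Set where
  constructor edgeSet
  field
    elements : List (Edge G)
    unique   : Unique elements

  size : ℕ
  size = length elements

open EdgeSet public using (elements; size)

-- The triangles of G with the edges of S deleted are the triangles of G none
-- of whose three edges lies in S.
RemovalMakesTriangleFree : ∀ {n} (G : MultiGraph n) → EdgeSet G → Set
RemovalMakesTriangleFree G S =
  ¬ (∃[ T ] All (_∉ elements S) (edges {G = G} T))

fromℕ : ℕ → ℚ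
fromℕ k = + k / 1

-- g(n) → ∞ as n → ∞.
TendsToInfinity : (ℕ → ℚ) → Set
TendsToInfinity g = ∀ (K : ℚ) → ∃[ N ] (∀ n → N ℕ.≤ n → K ℚ.≤ g n)

{-# OPTIONS --safe #-}
module Submission where

-- Suppose G has at most K n² triangles.  Deleting the edges which lie in
-- more than 4K triangles (in two of their three possible positions u < v < w)
-- costs at most n²/2 and leaves a graph E of bounded multiplicity in which every
-- vertex z is the largest in only O(n) triangles, but which still needs cn²
-- deletions.
--
-- A triangle-removal argument without densities shows that this is impossible
-- for large n.  Keep a set of pairs of vertices which is a union of products of
-- colour classes and contains all but o(n²) of E.  Since E is hard to cover, the
-- products A × B for which some z has at least |A|/L neighbours in A and |B|/L in
-- B have total area at least c'n²: otherwise delete the arcs in these products,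
-- the lost arcs, and the arcs xz with z having few neighbours in the class of x.
-- In each of these products remove N(z) ∩ A × N(z) ∩ B, a 1/L² part of it which
-- contains only O(n) arcs because each is in a triangle with z.  Refining the
-- colouring by the sets N(z), we obtain a smaller set of the same kind, so after
-- boundedly many rounds no area is left.

open import Defs
open import Data.Nat.Base using (ℕ; zero; suc; NonZero; _^_)
open import Data.Product.Base using (Σ-syntax; ∃-syntax; _×_; _,_; proj₁; proj₂)
open import Relation.Binary.PropositionalEquality
open import Relation.Nullary using (¬_; Dec; yes; no; does; ⌊_⌋; contradiction)

module Counting where

  open import Data.Nat.Base using (_+_; _*_; _≤_; _<_; z≤n; s≤s; z<s)
  open import Data.Nat.Properties as ℕ hiding (_<?_)
  open import Algebra.Properties.Semiring.Sum +-*-semiring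
  open import Data.Bool.Base using (Bool; true; false; if_then_else_; _∧_; not)
  open import Data.Fin.Base as Fin using (Fin; zero; suc; combine; remQuot; funToFin; finToFun)
  open import Data.Fin.Properties as Finₚ using (_<?_; any?; remQuot-combine; finToFun-funToFin)
  open import Data.List.Base using (List; []; _∷_; length; concat; tabulate)
  open import Data.List.Membership.Propositional using (_∈_)
  open import Data.List.Membership.Propositional.Properties
    using (∈-concat⁺′; ∈-concat⁻′; ∈-tabulate⁺; ∈-tabulate⁻)
  open import Data.List.Properties using (length-++; length-tabulate)
  open import Data.List.Relation.Unary.All using ([]; _∷_)
  import Data.List.Relation.Unary.All.Properties as All
  open import Data.List.Relation.Unary.AllPairs using ([])
  import Data.List.Relation.Unary.AllPairs.Properties as AllPairs
  open import Data.List.Relation.Unary.Unique.Propositional using (Unique)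
  import Data.List.Relation.Unary.Unique.Propositional.Properties as Unique
  open import Data.Nat.Tactic.RingSolver using (solve-∀)
  open import Data.Sum.Base using (_⊎_; inj₁; inj₂)
  open import Relation.Nullary.Decidable using (_×-dec_; dec-true)

  -- Finite sums and indicator functions

  sum-mono-≤ : ∀ {n} {f g : Fin n → ℕ} → (∀ i → f i ≤ g i) → sum f ≤ sum g
  sum-mono-≤ {zero}  f≤g = z≤n
  sum-mono-≤ {suc n} f≤g = +-mono-≤ (f≤g zero) (sum-mono-≤ (λ i → f≤g (suc i)))

  sum-const : ∀ n c → ∑[ i < n ] c ≡ n * c
  sum-const zero    c = refl
  sum-const (suc n) c = cong (c +_) (sum-const n c)

  sum-≤-const : ∀ {n} {f : Fin n → ℕ} {c} → (∀ i → f i ≤ c) → sum f ≤ n * c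
  sum-≤-const {n} f≤c = ≤-trans (sum-mono-≤ f≤c) (≤-reflexive (sum-const n _))

  term≤sum : ∀ {n} (f : Fin n → ℕ) i → f i ≤ sum f
  term≤sum f zero    = m≤m+n _ _
  term≤sum f (suc i) = ≤-trans (term≤sum (λ j → f (suc j)) i) (m≤n+m _ _)

  sum₂-cong : ∀ {m n} {f g : Fin m → Fin n → ℕ} → (∀ i j → f i j ≡ g i j) →
              ∑[ i < m ] ∑[ j < n ] f i j ≡ ∑[ i < m ] ∑[ j < n ] g i j
  sum₂-cong f≡g = sum-cong-≗ λ i → sum-cong-≗ (f≡g i)

  sum₂-mono-≤ : ∀ {m n} {f g : Fin m → Fin n → ℕ} → (∀ i j → f i j ≤ g i j) →
                ∑[ i < m ] ∑[ j < n ] f i j ≤ ∑[ i < m ] ∑[ j < n ] g i j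
  sum₂-mono-≤ f≤g = sum-mono-≤ λ i → sum-mono-≤ (f≤g i)

  sum₂-distrib-+ : ∀ {m n} (f g : Fin m → Fin n → ℕ) →
    ∑[ i < m ] ∑[ j < n ] (f i j + g i j) ≡
    ∑[ i < m ] ∑[ j < n ] f i j + ∑[ i < m ] ∑[ j < n ] g i j
  sum₂-distrib-+ f g =
    trans (sum-cong-≗ λ i → ∑-distrib-+ (f i) (g i)) (∑-distrib-+ (λ i → sum (f i)) _)

  *-distribˡ-sum₂ : ∀ {m n} c (f : Fin m → Fin n → ℕ) →
    c * (∑[ i < m ] ∑[ j < n ] f i j) ≡ ∑[ i < m ] ∑[ j < n ] (c * f i j)
  *-distribˡ-sum₂ c f =
    trans (*-distribˡ-sum c (λ i → sum (f i))) (sum-cong-≗ λ i → *-distribˡ-sum c (f i))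

  sum-*-sum : ∀ {m n} (f : Fin m → ℕ) (g : Fin n → ℕ) →
              ∑[ i < m ] ∑[ j < n ] (f i * g j) ≡ sum f * sum g
  sum-*-sum f g = trans (sum-cong-≗ λ i → sym (*-distribˡ-sum (f i) g))
                        (sym (*-distribʳ-sum (sum g) f))

  χ : Bool → ℕ
  χ true  = 1
  χ false = 0

  χ≤1 : ∀ b → χ b ≤ 1
  χ≤1 true  = ≤-refl
  χ≤1 false = z≤n

  -- Edge sets prescribed by weights on pairs

  length-concat-tabulate : ∀ {a} {A : Set a} {n} (f : Fin n → List A) →
    length (concat (tabulate f)) ≡ ∑[ i < n ] length (f i)
  length-concat-tabulate {n = zero}  f = refl
  length-concat-tabulate {n = suc n} f =
    trans (length-++ (f zero))
          (cong (length (f zero) +_) (length-concat-tabulate (λ i → f (suc i))))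

  module _ {a b} {A : Set a} {B : Set b} {n} (key : A → B) (val : Fin n → B)
           (val-injective : ∀ {i j} → val i ≡ val j → i ≡ j) where

    -- An element's `key` tells which list it comes from, so distinct lists are disjoint.
    concat-tabulate-unique : (f : Fin n → List A) →
      (∀ i → Unique (f i)) → (∀ i {x} → x ∈ f i → key x ≡ val i) →
      Unique (concat (tabulate f))
    concat-tabulate-unique f f-unique key-f =
      Unique.concat⁺ (All.tabulate⁺ f-unique)
        (AllPairs.tabulate⁺ λ i≢j (x∈fi , x∈fj) →
          i≢j (val-injective (trans (sym (key-f _ x∈fi)) (key-f _ x∈fj))))

  -- Every pair whose multiplicity is at most its weight is deleted completely.
  module Cover {n} (G : MultiGraph n) (ω : Fin n → Fin n → ℕ) where

    private m = mult G

    cheapEdges : Fin n → Fin n → List (Edge G)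
    cheapEdges u v with u <? v | m u v ≤? ω u v
    ... | yes u<v | yes _ = tabulate (edge u v u<v)
    ... | _       | _     = []

    cheapEdges-length : ∀ u v → length (cheapEdges u v) ≤ ω u v
    cheapEdges-length u v with u <? v | m u v ≤? ω u v
    ... | yes u<v | yes m≤ω = ≤-trans (≤-reflexive (length-tabulate (edge {G = G} u v u<v))) m≤ω
    ... | yes _   | no _    = z≤n
    ... | no _    | _       = z≤n

    edge-injective : ∀ {u v} .{u<v : u Fin.< v} {i j : Fin (m u v)} →
                     edge {G = G} u v u<v i ≡ edge u v u<v j → i ≡ j
    edge-injective refl = refl

    cheapEdges-unique : ∀ u v → Unique (cheapEdges u v)
    cheapEdges-unique u v with u <? v | m u v ≤? ω u v
    ... | yes u<v | yes _ = Unique.tabulate⁺ edge-injective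
    ... | yes _   | no _  = []
    ... | no _    | _     = []

    cheapEdges-ends : ∀ u v {e} → e ∈ cheapEdges u v → Edge.u e ≡ u × Edge.v e ≡ v
    cheapEdges-ends u v e∈ with u <? v | m u v ≤? ω u v
    cheapEdges-ends u v e∈ | yes u<v | yes _ with ∈-tabulate⁻ e∈
    ... | _ , refl = refl , refl

    cheapEdges-complete : ∀ u v (u<v : u Fin.< v) i → m u v ≤ ω u v →
                          edge u v u<v i ∈ cheapEdges u v
    cheapEdges-complete u v u<v i m≤ω with u <? v | m u v ≤? ω u v
    ... | yes _  | yes _  = ∈-tabulate⁺ {f = edge {G = G} u v u<v} i
    ... | yes _  | no m≰ω = contradiction m≤ω m≰ω
    ... | no u≮v | _      = contradiction u<v u≮v

    cheapFrom : Fin n → List (Edge G)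
    cheapFrom u = concat (tabulate (cheapEdges u))

    cheapFrom-start : ∀ u {e} → e ∈ cheapFrom u → Edge.u e ≡ u
    cheapFrom-start u e∈ with ∈-concat⁻′ _ e∈
    ... | _ , e∈es , es∈ with ∈-tabulate⁻ {f = cheapEdges u} es∈
    ... | v , refl = proj₁ (cheapEdges-ends u v e∈es)

    cheap : EdgeSet G
    cheap = edgeSet (concat (tabulate cheapFrom))
      (concat-tabulate-unique Edge.u (λ u → u) (λ eq → eq) cheapFrom
        (λ u → concat-tabulate-unique Edge.v (λ v → v) (λ eq → eq) (cheapEdges u)
          (cheapEdges-unique u) (λ v e∈ → proj₂ (cheapEdges-ends u v e∈)))
        cheapFrom-start)

    cheap-size : size cheap ≤ ∑[ u < n ] ∑[ v < n ] ω u v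
    cheap-size = begin
      size cheap                                     ≡⟨ length-concat-tabulate cheapFrom ⟩
      ∑[ u < n ] length (cheapFrom u)                ≡⟨ sum-cong-≗ (λ u → length-concat-tabulate (cheapEdges u)) ⟩
      ∑[ u < n ] ∑[ v < n ] length (cheapEdges u v)  ≤⟨ sum₂-mono-≤ cheapEdges-length ⟩
      ∑[ u < n ] ∑[ v < n ] ω u v                    ∎
      where open ≤-Reasoning

    cheap-complete : ∀ u v (u<v : u Fin.< v) i → m u v ≤ ω u v → edge u v u<v i ∈ elements cheap
    cheap-complete u v u<v i m≤ω =
      ∈-concat⁺′ (∈-concat⁺′ (cheapEdges-complete u v u<v i m≤ω) (∈-tabulate⁺ v)) (∈-tabulate⁺ u)

  -- Deletion sets enter the argument only through such weights. A weight below the multiplicity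
  -- deletes nothing but still counts as cost, so weights from different sources can simply be
  -- added.
  CoveringWeight : ∀ {n} → MultiGraph n → (Fin n → Fin n → ℕ) → Set
  CoveringWeight G ω = ∀ u v w → u Fin.< v → v Fin.< w →
    0 < mult G u v → 0 < mult G v w → 0 < mult G u w →
    mult G u v ≤ ω u v ⊎ mult G v w ≤ ω v w ⊎ mult G u w ≤ ω u w

  HardToCover : ∀ {n} → MultiGraph n → Set
  HardToCover {n} G = ∀ (S : EdgeSet G) → RemovalMakesTriangleFree G S → n ^ 2 ≤ size S

  Fin⇒0< : ∀ {n} → Fin n → 0 < n
  Fin⇒0< zero    = z<s
  Fin⇒0< (suc _) = z<s

  -- In every triangle some pair is deleted completely, so `cheap` is a legitimate deletion set.
  coveringWeight-bound : ∀ {n} {G : MultiGraph n} → HardToCover G → ∀ {ω} → CoveringWeight G ω →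
                         n ^ 2 ≤ ∑[ u < n ] ∑[ v < n ] ω u v
  coveringWeight-bound {G = G} hard {ω} covering = ≤-trans (hard cheap free) cheap-size
    where
    open Cover G ω
    free : RemovalMakesTriangleFree G cheap
    free (triangle u v w u<v v<w uv vw uw , uv∉ ∷ vw∉ ∷ uw∉ ∷ [])
      with covering u v w u<v v<w (Fin⇒0< uv) (Fin⇒0< vw) (Fin⇒0< uw)
    ... | inj₁ uv-cheap        = uv∉ (cheap-complete u v u<v uv uv-cheap)
    ... | inj₂ (inj₁ vw-cheap) = vw∉ (cheap-complete v w v<w vw vw-cheap)
    ... | inj₂ (inj₂ uw-cheap) = uw∉ (cheap-complete u w (Finₚ.<-trans u<v v<w) uw uw-cheap)

  -- The refinement step

  -- A total choice: `z₀` is returned as a placeholder when `P` holds nowhere.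
  choose : ∀ {n p} {P : Fin n → Set p} → Fin n → (∀ z → Dec (P z)) → ∃[ z ] (∀ z′ → P z′ → P z)
  choose z₀ P? with any? P?
  ... | yes (z , Pz) = z  , λ _ _ → Pz
  ... | no ¬P        = z₀ , λ z′ Pz′ → contradiction (z′ , Pz′) ¬P

  sum-δ : ∀ {k} (j : Fin k) (f : Fin k → ℕ) → ∑[ i < k ] (χ (does (j Finₚ.≟ i)) * f i) ≡ f j
  sum-δ {suc k} zero f =
    trans (cong₂ _+_ (+-identityʳ (f zero)) (sum-replicate-zero k)) (+-identityʳ (f zero))
  sum-δ (suc j) f = sum-δ j (λ i → f (suc i))

  module Colouring {n k} (c : Fin n → Fin k) where

    inClass : Fin k → Fin n → ℕ
    inClass i x = χ (does (c x Finₚ.≟ i))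

    sum-by-class : (f : Fin k → Fin n → ℕ) →
      ∑[ x < n ] f (c x) x ≡ ∑[ i < k ] ∑[ x < n ] (inClass i x * f i x)
    sum-by-class f =
      trans (sum-cong-≗ λ x → sym (sum-δ (c x) (λ i → f i x)))
            (∑-comm λ x i → inClass i x * f i x)

    sum₂-by-class : (f : Fin k → Fin k → Fin n → Fin n → ℕ) →
      ∑[ x < n ] ∑[ y < n ] f (c x) (c y) x y ≡
      ∑[ i < k ] ∑[ j < k ] ∑[ x < n ] ∑[ y < n ] (inClass i x * (inClass j y * f i j x y))
    sum₂-by-class f = begin
      ∑[ x < n ] ∑[ y < n ] f (c x) (c y) x y
        ≡⟨ sum-by-class (λ i x → ∑[ y < n ] f i (c y) x y) ⟩
      ∑[ i < k ] ∑[ x < n ] (inClass i x * (∑[ y < n ] f i (c y) x y))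
        ≡⟨ (sum₂-cong λ i x → cong (inClass i x *_) (sum-by-class (λ j y → f i j x y))) ⟩
      ∑[ i < k ] ∑[ x < n ] (inClass i x * (∑[ j < k ] ∑[ y < n ] (inClass j y * f i j x y)))
        ≡⟨ (sum₂-cong λ i x → *-distribˡ-sum₂ (inClass i x) (λ j y → inClass j y * f i j x y)) ⟩
      ∑[ i < k ] ∑[ x < n ] ∑[ j < k ] ∑[ y < n ] (inClass i x * (inClass j y * f i j x y))
        ≡⟨ (sum-cong-≗ λ i → ∑-comm (λ x j → ∑[ y < n ] (inClass i x * (inClass j y * f i j x y)))) ⟩
      ∑[ i < k ] ∑[ j < k ] ∑[ x < n ] ∑[ y < n ] (inClass i x * (inClass j y * f i j x y))  ∎
      where open ≡-Reasoning

    -- Within a fixed pair of classes the summand is a product of a function of `x` and one of `y`,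
    -- so the double sum factors. Both the area of the good products and the part removed from them
    -- are computed this way.
    sum-rectangles : (q : Fin k → Fin k → ℕ) (f g : Fin k → Fin k → Fin n → ℕ) →
      ∑[ x < n ] ∑[ y < n ] (q (c x) (c y) * (f (c x) (c y) x * g (c x) (c y) y)) ≡
      ∑[ i < k ] ∑[ j < k ]
        (q i j * ((∑[ x < n ] (inClass i x * f i j x)) * (∑[ y < n ] (inClass j y * g i j y))))
    sum-rectangles q f g =
      trans (sum₂-by-class λ i j x y → q i j * (f i j x * g i j y)) (sum₂-cong λ i j → begin
        ∑[ x < n ] ∑[ y < n ] (inClass i x * (inClass j y * (q i j * (f i j x * g i j y))))
          ≡⟨ (sum₂-cong λ x y → regroup (inClass i x) (inClass j y) (q i j) (f i j x) (g i j y)) ⟩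
        ∑[ x < n ] ∑[ y < n ] (q i j * ((inClass i x * f i j x) * (inClass j y * g i j y)))
          ≡⟨ *-distribˡ-sum₂ (q i j) (λ x y → (inClass i x * f i j x) * (inClass j y * g i j y)) ⟨
        q i j * (∑[ x < n ] ∑[ y < n ] ((inClass i x * f i j x) * (inClass j y * g i j y)))
          ≡⟨ cong (q i j *_) (sum-*-sum (λ x → inClass i x * f i j x) (λ y → inClass j y * g i j y)) ⟩
        q i j * ((∑[ x < n ] (inClass i x * f i j x)) * (∑[ y < n ] (inClass j y * g i j y)))  ∎)
      where
      open ≡-Reasoning
      regroup : ∀ a b q f g → a * (b * (q * (f * g))) ≡ q * ((a * f) * (b * g))
      regroup = solve-∀

    -- The factor 1 makes this literally the inner sum of `sum-rectangles` for a constant function.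
    classSize : Fin k → ℕ
    classSize i = ∑[ x < n ] (inClass i x * 1)

    sum-classSize : ∑[ i < k ] classSize i ≡ n
    sum-classSize = trans (sym (sum-by-class λ _ _ → 1)) (trans (sum-const n 1) (*-identityʳ n))

  -- Robust digraphs and one refinement of a pattern

  -- A digraph all of whose transitive triangles can only be destroyed by
  -- deleting at least n²/R arcs.
  RobustTriangles : ∀ {n} → (Fin n → Fin n → Bool) → ℕ → Set
  RobustTriangles {n} E R = ∀ (ω : Fin n → Fin n → ℕ) →
    (∀ x y z → E x y ≡ true → E y z ≡ true → E x z ≡ true → 0 < ω x y ⊎ 0 < ω y z ⊎ 0 < ω x z) →
    n ^ 2 ≤ R * (∑[ x < n ] ∑[ y < n ] ω x y)

  FewTrianglesTo : ∀ {n} → (Fin n → Fin n → Bool) → ℕ → Set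
  FewTrianglesTo {n} E D =
    ∀ z → ∑[ x < n ] ∑[ y < n ] (χ (E x y) * (χ (E x z) * χ (E y z))) ≤ D

  -- A set of pairs of vertices (the inside) that is a union of products of
  -- colour classes; an arc outside it is lost.
  record Pattern (n : ℕ) : Set where
    field
      colours : ℕ
      colour  : Fin n → Fin colours
      present : Fin colours → Fin colours → Bool

    inside : Fin n → Fin n → Bool
    inside x y = present (colour x) (colour y)

    area : ℕ
    area = ∑[ x < n ] ∑[ y < n ] χ (inside x y)

    lost : (Fin n → Fin n → Bool) → ℕ
    lost E = ∑[ x < n ] ∑[ y < n ] χ (E x y ∧ not (inside x y))

  bit : Bool → Fin 2
  bit true  = suc zero
  bit false = zero

  unbit : Fin 2 → Bool
  unbit zero    = false
  unbit (suc _) = true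

  unbit-bit : ∀ b → unbit (bit b) ≡ b
  unbit-bit true  = refl
  unbit-bit false = refl

  χ-split : ∀ h g a b → χ (h ∧ not (g ∧ (a ∧ b))) + χ (h ∧ g) * (χ a * χ b) ≡ χ h
  χ-split false _     _     _     = refl
  χ-split true  false _     _     = refl
  χ-split true  true  false _     = refl
  χ-split true  true  true  false = refl
  χ-split true  true  true  true  = refl

  -- Here `h` stands for inside, `g` for a good product, and `a`, `b` for adjacency to its witness.
  -- A newly lost arc has both ends adjacent to the witness and so forms a triangle with it.
  χ-loss : ∀ e h g a b →
    χ (e ∧ not (h ∧ not (g ∧ (a ∧ b)))) ≤ χ (e ∧ not h) + χ e * (χ a * χ b)
  χ-loss false _     _     _     _     = z≤n
  χ-loss true  false _     _     _     = s≤s z≤n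
  χ-loss true  true  false _     _     = z≤n
  χ-loss true  true  true  false _     = z≤n
  χ-loss true  true  true  true  false = z≤n
  χ-loss true  true  true  true  true  = ≤-refl

  module Refine {n} (z₀ : Fin n) (E : Fin n → Fin n → Bool) (R D : ℕ)
                (robust : RobustTriangles E R) (few : FewTrianglesTo E D) (P : Pattern n) where

    open Pattern P
    open Colouring colour

    private
      k = colours
      -- With this choice the bad arcs number at most n²/(4R), a quarter of what robustness demands.
      L = 4 * R

    nbrs : Fin n → Fin k → ℕ
    nbrs z i = ∑[ x < n ] (inClass i x * χ (E x z))

    abstract
      sparse? : ∀ z i → Dec (L * nbrs z i < classSize i)
      sparse? z i = L * nbrs z i ℕ.<? classSize i

    bad : Fin n → Fin n → ℕ
    bad x z = χ (E x z) * χ (does (sparse? z (colour x)))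

    -- A class that is sparse for `z` contributes less than a 1/L part of its size, and the class
    -- sizes add up to n.
    bad-bound : ∀ z → L * (∑[ x < n ] bad x z) ≤ n
    bad-bound z = begin
      L * (∑[ x < n ] bad x z)
        ≡⟨ cong (L *_) (sum-by-class (λ i x → χ (E x z) * χ (does (sparse? z i)))) ⟩
      L * (∑[ i < k ] ∑[ x < n ] (inClass i x * (χ (E x z) * χ (does (sparse? z i)))))
        ≡⟨ cong (L *_) (sum-cong-≗ factor) ⟩
      L * (∑[ i < k ] (nbrs z i * χ (does (sparse? z i))))
        ≡⟨ *-distribˡ-sum L (λ i → nbrs z i * χ (does (sparse? z i))) ⟩
      ∑[ i < k ] (L * (nbrs z i * χ (does (sparse? z i))))
        ≤⟨ sum-mono-≤ small ⟩
      ∑[ i < k ] classSize i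
        ≡⟨ sum-classSize ⟩
      n ∎
      where
      open ≤-Reasoning
      factor : ∀ i → ∑[ x < n ] (inClass i x * (χ (E x z) * χ (does (sparse? z i)))) ≡
                     nbrs z i * χ (does (sparse? z i))
      factor i = trans (sum-cong-≗ λ x → sym (*-assoc (inClass i x) (χ (E x z)) _))
                       (sym (*-distribʳ-sum _ (λ x → inClass i x * χ (E x z))))
      small : ∀ i → L * (nbrs z i * χ (does (sparse? z i))) ≤ classSize i
      small i with sparse? z i
      ... | yes sp = <⇒≤ (≤-<-trans (≤-reflexive (cong (L *_) (*-identityʳ _))) sp)
      ... | no _   = ≤-trans (≤-reflexive (trans (cong (L *_) (*-zeroʳ (nbrs z i))) (*-zeroʳ L))) z≤n

    bad-total : L * (∑[ x < n ] ∑[ z < n ] bad x z) ≤ n ^ 2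
    bad-total = begin
      L * (∑[ x < n ] ∑[ z < n ] bad x z)    ≡⟨ cong (L *_) (∑-comm bad) ⟩
      L * (∑[ z < n ] ∑[ x < n ] bad x z)    ≡⟨ *-distribˡ-sum L (λ z → ∑[ x < n ] bad x z) ⟩
      ∑[ z < n ] (L * (∑[ x < n ] bad x z))  ≤⟨ sum-≤-const bad-bound ⟩
      n * n                                  ≡⟨ cong (n *_) (*-identityʳ n) ⟨
      n ^ 2                                  ∎
      where open ≤-Reasoning

    -- For such a z the neighbours of z fill at least a 1/L² part of the product of
    -- classes i and j, while hardly any arc joins two neighbours of z.
    Dense : Fin k → Fin k → Fin n → Set
    Dense i j z = classSize i ≤ L * nbrs z i × classSize j ≤ L * nbrs z j

    abstract
      dense? : ∀ i j z → Dec (Dense i j z)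
      dense? i j z = (classSize i ≤? L * nbrs z i) ×-dec (classSize j ≤? L * nbrs z j)

    -- One vertex serves each product of classes, so a refinement has to split the classes by only
    -- k² neighbourhoods.
    witness : Fin k → Fin k → Fin n
    witness i j = proj₁ (choose z₀ (dense? i j))

    good : Fin k → Fin k → Bool
    good i j = does (dense? i j (witness i j))

    Dense⇒good : ∀ i j z → Dense i j z → good i j ≡ true
    Dense⇒good i j z d = dec-true (dense? i j _) (proj₂ (choose z₀ (dense? i j)) z d)

    goodAt removedAt : Fin n → Fin n → ℕ
    goodAt x y = χ (inside x y ∧ good (colour x) (colour y)) * (1 * 1)
    removedAt x y = χ (inside x y ∧ good (colour x) (colour y)) *
      (χ (E x (witness (colour x) (colour y))) * χ (E y (witness (colour x) (colour y))))

    goodArea removed : ℕ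
    goodArea = ∑[ x < n ] ∑[ y < n ] goodAt x y
    removed  = ∑[ x < n ] ∑[ y < n ] removedAt x y

    -- In a good product A × B the witness has at least |A|/L neighbours in A and |B|/L in B;
    -- multiplying the two bounds gives the factor L².
    goodArea≤removed : goodArea ≤ L * L * removed
    goodArea≤removed = begin
      goodArea
        ≡⟨ sum-rectangles (λ i j → χ (present i j ∧ good i j)) (λ _ _ _ → 1) (λ _ _ _ → 1) ⟩
      ∑[ i < k ] ∑[ j < k ] (χ (present i j ∧ good i j) * (classSize i * classSize j))
        ≤⟨ sum₂-mono-≤ dense ⟩
      ∑[ i < k ] ∑[ j < k ]
        (L * L * (χ (present i j ∧ good i j) * (nbrs (witness i j) i * nbrs (witness i j) j)))
        ≡⟨ *-distribˡ-sum₂ (L * L) (λ i j → χ (present i j ∧ good i j) * (nbrs (witness i j) i * nbrs (witness i j) j)) ⟨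
      L * L * (∑[ i < k ] ∑[ j < k ]
        (χ (present i j ∧ good i j) * (nbrs (witness i j) i * nbrs (witness i j) j)))
        ≡⟨ cong (L * L *_) (sum-rectangles (λ i j → χ (present i j ∧ good i j))
             (λ i j x → χ (E x (witness i j))) (λ i j y → χ (E y (witness i j)))) ⟨
      L * L * removed ∎
      where
      open ≤-Reasoning
      regroup : ∀ L a b → (L * a) * (L * b) ≡ L * L * (1 * (a * b))
      regroup = solve-∀
      dense : ∀ i j → χ (present i j ∧ good i j) * (classSize i * classSize j) ≤
        L * L * (χ (present i j ∧ good i j) * (nbrs (witness i j) i * nbrs (witness i j) j))
      dense i j with present i j | dense? i j (witness i j)
      ... | false | _           = z≤n
      ... | true  | no _        = z≤n
      ... | true  | yes (p , q) = ≤-trans (≤-reflexive (*-identityˡ _))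
        (≤-trans (*-mono-≤ p q) (≤-reflexive (regroup L _ _)))

    -- Bad arcs, lost arcs and good products together meet every transitive triangle xyz. If `z` is
    -- sparse for the class of `x` or of `y`, then xz or yz is bad; otherwise `z` is dense for the
    -- product containing xy, and this pair is either lost or in a good product.
    covered : n ^ 2 ≤ R * ((∑[ x < n ] ∑[ y < n ] bad x y) + lost E + goodArea)
    covered = begin
      n ^ 2                                ≤⟨ robust ω ω-covers ⟩
      R * (∑[ x < n ] ∑[ y < n ] ω x y)    ≡⟨ cong (R *_) (trans (sum₂-distrib-+ (λ x y → bad x y + lostAt x y) goodAt)
                                                (cong (_+ goodArea) (sum₂-distrib-+ bad lostAt))) ⟩
      R * ((∑[ x < n ] ∑[ y < n ] bad x y) + lost E + goodArea) ∎
      where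
      open ≤-Reasoning
      lostAt ω : Fin n → Fin n → ℕ
      lostAt x y = χ (E x y ∧ not (inside x y))
      ω x y = bad x y + lostAt x y + goodAt x y
      bad≤ω : ∀ x y → bad x y ≤ ω x y
      bad≤ω x y = ≤-trans (m≤m+n _ _) (m≤m+n _ _)
      sparse⇒bad : ∀ x z → E x z ≡ true → L * nbrs z (colour x) < classSize (colour x) → 0 < bad x z
      sparse⇒bad x z Exz sp rewrite Exz | dec-true (sparse? z (colour x)) sp = z<s
      goodAt-positive : ∀ x y z → inside x y ≡ true → Dense (colour x) (colour y) z → 0 < goodAt x y
      goodAt-positive x y z ins d rewrite ins | Dense⇒good (colour x) (colour y) z d = z<s
      lostAt-positive : ∀ x y → E x y ≡ true → inside x y ≡ false → 0 < lostAt x y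
      lostAt-positive x y Exy out rewrite Exy | out = z<s
      ω-covers : ∀ x y z → E x y ≡ true → E y z ≡ true → E x z ≡ true →
                 0 < ω x y ⊎ 0 < ω y z ⊎ 0 < ω x z
      ω-covers x y z Exy Eyz Exz =
        by-cases (sparse? z (colour x)) (sparse? z (colour y)) (inside x y) refl
        where
        by-cases : Dec (L * nbrs z (colour x) < classSize (colour x)) →
                   Dec (L * nbrs z (colour y) < classSize (colour y)) →
                   ∀ b → inside x y ≡ b → 0 < ω x y ⊎ 0 < ω y z ⊎ 0 < ω x z
        by-cases (yes sp) _        _     _   =
          inj₂ (inj₂ (<-≤-trans (sparse⇒bad x z Exz sp) (bad≤ω x z)))
        by-cases (no _)   (yes sp) _     _   =
          inj₂ (inj₁ (<-≤-trans (sparse⇒bad y z Eyz sp) (bad≤ω y z)))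
        by-cases (no _)   (no _)   false out =
          inj₁ (<-≤-trans (lostAt-positive x y Exy out) (≤-trans (m≤n+m _ (bad x y)) (m≤m+n _ _)))
        by-cases (no dx)  (no dy)  true  ins =
          inj₁ (<-≤-trans (goodAt-positive x y z ins (≮⇒≥ dx , ≮⇒≥ dy)) (m≤n+m _ _))

    -- Four copies of `covered` are added: bad and lost arcs account for at most one n² each, so the
    -- good area is at least n²/(2R).
    removed-large : 4 * R * lost E ≤ n ^ 2 → n ^ 2 ≤ 2 * R * (L * L) * removed
    removed-large lost-small =
      ≤-trans (*-cancelˡ-≤ 2 (+-cancelˡ-≤ (N + N) _ _ (begin
        N + N + 2 * N                                    ≡⟨ e₁ N ⟩
        4 * N                                            ≤⟨ *-monoʳ-≤ 4 covered ⟩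
        4 * (R * (B + lost E + goodArea))                ≡⟨ e₂ R B (lost E) goodArea ⟩
        4 * R * B + 4 * R * lost E + 2 * (2 * R * goodArea)
          ≤⟨ +-monoˡ-≤ _ (+-mono-≤ bad-total lost-small) ⟩
        N + N + 2 * (2 * R * goodArea)                   ∎)))
        (≤-trans (*-monoʳ-≤ (2 * R) goodArea≤removed)
                 (≤-reflexive (sym (*-assoc (2 * R) (L * L) removed))))
      where
      open ≤-Reasoning
      N = n ^ 2
      B = ∑[ x < n ] ∑[ y < n ] bad x y
      e₁ : ∀ N → N + N + 2 * N ≡ 4 * N
      e₁ = solve-∀
      e₂ : ∀ R B l g → 4 * (R * (B + l + g)) ≡ 4 * R * B + 4 * R * l + 2 * (2 * R * g)
      e₂ = solve-∀

    seen : Fin n → Fin (k * k) → Fin 2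
    seen x p = let (i , j) = remQuot k p in bit (E x (witness i j))

    oldColour : Fin (k * 2 ^ (k * k)) → Fin k
    oldColour a = proj₁ (remQuot (2 ^ (k * k)) a)

    -- The second component of a new colour lists, for each of the k² products of
    -- old classes, whether the vertex is a neighbour of that product's witness.
    adjacent : Fin (k * 2 ^ (k * k)) → Fin k → Fin k → Bool
    adjacent a i j = unbit (finToFun (proj₂ (remQuot {k} (2 ^ (k * k)) a)) (combine i j))

    newColour : Fin n → Fin (k * 2 ^ (k * k))
    newColour x = combine (colour x) (funToFin (seen x))

    oldColour-newColour : ∀ x → oldColour (newColour x) ≡ colour x
    oldColour-newColour x = cong proj₁ (remQuot-combine (colour x) (funToFin (seen x)))

    adjacent-newColour : ∀ x i j → adjacent (newColour x) i j ≡ E x (witness i j)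
    adjacent-newColour x i j =
      trans (cong (λ q → unbit (finToFun (proj₂ q) (combine i j)))
                  (remQuot-combine (colour x) (funToFin (seen x))))
     (trans (cong unbit (finToFun-funToFin (seen x) (combine i j)))
     (trans (cong (λ q → unbit (bit (E x (witness (proj₁ q) (proj₂ q))))) (remQuot-combine i j))
            (unbit-bit _)))

    kept : Fin k → Fin k → Bool → Bool → Bool
    kept i j a b = present i j ∧ not (good i j ∧ (a ∧ b))

    refined : Pattern n
    refined = record
      { colours = k * 2 ^ (k * k)
      ; colour  = newColour
      ; present = λ a b → let i = oldColour a; j = oldColour b in
                          kept i j (adjacent a i j) (adjacent b i j)
      }

    -- A new colour determines the old one and the adjacency to all witnesses, so the refined
    -- pattern can be compared with the old one pair by pair.
    refined-inside : ∀ x y → let w = witness (colour x) (colour y) in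
      Pattern.inside refined x y ≡ kept (colour x) (colour y) (E x w) (E y w)
    refined-inside x y =
      trans (cong₂ (λ i j → kept i j (adjacent (newColour x) i j) (adjacent (newColour y) i j))
                   (oldColour-newColour x) (oldColour-newColour y))
            (cong₂ (kept (colour x) (colour y))
                   (adjacent-newColour x (colour x) (colour y))
                   (adjacent-newColour y (colour x) (colour y)))

    refined-area : Pattern.area refined + removed ≡ area
    refined-area =
      trans (sym (sum₂-distrib-+ (λ x y → χ (Pattern.inside refined x y)) removedAt))
            (sum₂-cong λ x y → trans (cong (λ b → χ b + removedAt x y) (refined-inside x y))
              (χ-split (inside x y) (good (colour x) (colour y))
                       (E x (witness (colour x) (colour y))) (E y (witness (colour x) (colour y)))))

    -- In each of the k² products the newly lost arcs lie in triangles ending at a single witness,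
    -- hence number at most `D`.
    refined-lost : Pattern.lost refined E ≤ lost E + k * (k * D)
    refined-lost = begin
      Pattern.lost refined E
        ≤⟨ sum₂-mono-≤ (λ x y → ≤-trans
             (≤-reflexive (cong (λ b → χ (E x y ∧ not b)) (refined-inside x y)))
             (χ-loss (E x y) (inside x y) (good (colour x) (colour y))
                     (E x (witness (colour x) (colour y))) (E y (witness (colour x) (colour y))))) ⟩
      ∑[ x < n ] ∑[ y < n ] (χ (E x y ∧ not (inside x y)) + T (colour x) (colour y) x y)
        ≡⟨ sum₂-distrib-+ (λ x y → χ (E x y ∧ not (inside x y))) (λ x y → T (colour x) (colour y) x y) ⟩
      lost E + ∑[ x < n ] ∑[ y < n ] T (colour x) (colour y) x y
        ≡⟨ cong (lost E +_) (sum₂-by-class T) ⟩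
      lost E + ∑[ i < k ] ∑[ j < k ] ∑[ x < n ] ∑[ y < n ] (inClass i x * (inClass j y * T i j x y))
        ≤⟨ +-monoʳ-≤ (lost E) (sum-≤-const λ i → sum-≤-const λ j →
             ≤-trans (sum₂-mono-≤ λ x y → ≤-trans (drop i x _) (drop j y _)) (few (witness i j))) ⟩
      lost E + k * (k * D) ∎
      where
      open ≤-Reasoning
      T : Fin k → Fin k → Fin n → Fin n → ℕ
      T i j x y = χ (E x y) * (χ (E x (witness i j)) * χ (E y (witness i j)))
      drop : ∀ i x t → inClass i x * t ≤ t
      drop i x t = ≤-trans (*-monoˡ-≤ t (χ≤1 (does (colour x Finₚ.≟ i)))) (≤-reflexive (*-identityˡ t))

  -- Iterating the refinement

  -- The number of colours after s refinements.
  cells : ℕ → ℕ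
  cells zero    = 1
  cells (suc s) = cells s * 2 ^ (cells s * cells s)

  lossFactor : ℕ → ℕ
  lossFactor zero    = 0
  lossFactor (suc s) = lossFactor s + cells s * cells s

  module _ {n} (z₀ : Fin n) (E : Fin n → Fin n → Bool) (R D : ℕ)
           (robust : RobustTriangles E R) (few : FewTrianglesTo E D) where

    private
      N = n ^ 2
      W = 2 * R * ((4 * R) * (4 * R))

    -- The area serves as a potential: every round lowers W times the area by at least n². The
    -- hypothesis keeps the lost arcs below n²/(4R), as `removed-large` requires, and passes to
    -- earlier rounds because `lossFactor` is increasing.
    iterate : ∀ s → 4 * R * (lossFactor s * D) ≤ N →
      Σ[ P ∈ Pattern n ] Pattern.colours P ≡ cells s ×
                         W * Pattern.area P + s * N ≤ W * N ×
                         Pattern.lost P E ≤ lossFactor s * D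
    iterate zero _ = everything , refl , area-bound , lost-bound
      where
      everything : Pattern n
      everything = record { colours = 1 ; colour = λ _ → zero ; present = λ _ _ → true }
      area-bound : W * Pattern.area everything + 0 ≤ W * N
      area-bound = ≤-trans (≤-reflexive (+-identityʳ (W * Pattern.area everything)))
        (*-monoʳ-≤ W (sum-≤-const {n} λ x → sum-≤-const {n} λ y → ≤-refl))
      lost-bound : Pattern.lost everything E ≤ 0
      lost-bound = ≤-trans (sum-≤-const λ x → sum-≤-const λ y → ≤-reflexive (nothing (E x y)))
        (≤-reflexive (trans (cong (n *_) (*-zeroʳ n)) (*-zeroʳ n)))
        where
        nothing : ∀ b → χ (b ∧ false) ≡ 0
        nothing true  = refl
        nothing false = refl
    iterate (suc s) small
      with iterate s (≤-trans (*-monoʳ-≤ (4 * R)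
        (*-monoˡ-≤ D (m≤m+n (lossFactor s) (cells s * cells s)))) small)
    -- Matching on `refl` identifies the number of colours with `cells s`, so the refined pattern
    -- has `cells (suc s)` colours by computation.
    ... | P , refl , area-bound , lost-bound =
      refined , refl , area-bound′ , lost-bound′
      where
      open Refine z₀ E R D robust few P
      open ≤-Reasoning
      lost-small : 4 * R * Pattern.lost P E ≤ N
      lost-small = ≤-trans (*-monoʳ-≤ (4 * R)
        (≤-trans lost-bound (*-monoˡ-≤ D (m≤m+n (lossFactor s) (cells s * cells s))))) small
      area-bound′ : W * Pattern.area refined + (N + s * N) ≤ W * N
      area-bound′ = begin
        W * Pattern.area refined + (N + s * N)          ≡⟨ +-assoc (W * Pattern.area refined) N (s * N) ⟨
        W * Pattern.area refined + N + s * N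
          ≤⟨ +-monoˡ-≤ (s * N) (+-monoʳ-≤ (W * Pattern.area refined) (removed-large lost-small)) ⟩
        W * Pattern.area refined + W * removed + s * N
          ≡⟨ cong (_+ s * N) (*-distribˡ-+ W (Pattern.area refined) removed) ⟨
        W * (Pattern.area refined + removed) + s * N    ≡⟨ cong (λ a → W * a + s * N) refined-area ⟩
        W * Pattern.area P + s * N                      ≤⟨ area-bound ⟩
        W * N                                           ∎
      lost-bound′ : Pattern.lost refined E ≤ (lossFactor s + cells s * cells s) * D
      lost-bound′ = begin
        Pattern.lost refined E                              ≤⟨ refined-lost ⟩
        Pattern.lost P E + cells s * (cells s * D)          ≤⟨ +-monoˡ-≤ _ lost-bound ⟩
        lossFactor s * D + cells s * (cells s * D)          ≡⟨ cong (lossFactor s * D +_) (*-assoc (cells s) (cells s) D) ⟨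
        lossFactor s * D + cells s * cells s * D            ≡⟨ *-distribʳ-+ D (lossFactor s) (cells s * cells s) ⟨
        (lossFactor s + cells s * cells s) * D              ∎

  rounds : ℕ → ℕ
  rounds R = suc (2 * R * ((4 * R) * (4 * R)))

  -- The smallness condition of `iterate` for D = nC and the last round, with one factor n
  -- cancelled.
  removal-threshold : ℕ → ℕ → ℕ
  removal-threshold R C = 4 * R * (lossFactor (rounds R) * C)

  no-robust : ∀ R C {n} → 0 < n → removal-threshold R C ≤ n →
              (E : Fin n → Fin n → Bool) → RobustTriangles E R → ¬ FewTrianglesTo E (n * C)
  no-robust R C {n@(suc _)} _ large E robust few
    with iterate zero E R (n * C) robust few (rounds R)
      (≤-trans (≤-reflexive (regroup R (lossFactor (rounds R)) n C))
               (≤-trans (*-monoʳ-≤ n large) (≤-reflexive (cong (n *_) (sym (*-identityʳ n))))))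
    where
    regroup : ∀ R l n C → 4 * R * (l * (n * C)) ≡ n * (4 * R * (l * C))
    regroup = solve-∀
  ... | P , _ , area-bound , _ =
    -- The number of rounds is W + 1, so the area bound contains (W + 1)n² ≤ Wn², which is false for
    -- positive n.
    <-irrefl refl (<-≤-trans (m<n+m _ z<s) (≤-trans (m≤n+m _ _) area-bound))

  -- Reduction from multigraphs

  if-scale : ∀ (b : Bool) c x {y} → c * x ≡ y → c * (if b then x else 0) ≡ (if b then y else 0)
  if-scale true  c x eq = eq
  if-scale false c x _  = *-zeroʳ c

  module Light {n} (G : MultiGraph n) where

    private m = mult G

    between : Fin n → Fin n → Fin n → Bool
    between u v w = ⌊ u <? v ⌋ ∧ ⌊ v <? w ⌋

    between-true : ∀ {u v w} → u Fin.< v → v Fin.< w → between u v w ≡ true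
    between-true {u} {v} {w} u<v v<w with u <? v | v <? w
    ... | yes _  | yes _  = refl
    ... | no u≮v | _      = contradiction u<v u≮v
    ... | yes _  | no v≮w = contradiction v<w v≮w

    -- The number of triangles through a given edge joining the smallest and largest vertex,
    -- respectively the two smaller vertices. Together these two positions control all three
    -- multiplicities of a triangle.
    codeg codeg⁺ : Fin n → Fin n → ℕ
    codeg  u w = ∑[ v < n ] (if between u v w then m u v * m v w else 0)
    codeg⁺ u v = ∑[ w < n ] (if between u v w then m v w * m u w else 0)

    codeg-sum : ∑[ u < n ] ∑[ w < n ] (m u w * codeg u w) ≡ numTriangles G
    codeg-sum = trans
      (sum₂-cong λ u w → trans
        (*-distribˡ-sum (m u w) (λ v → if between u v w then m u v * m v w else 0))
        (sum-cong-≗ λ v → if-scale (between u v w) (m u w) (m u v * m v w) (*-comm (m u w) (m u v * m v w))))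
      (sum-cong-≗ λ u → ∑-comm λ w v → if between u v w then m u v * m v w * m u w else 0)

    codeg⁺-sum : ∑[ u < n ] ∑[ v < n ] (m u v * codeg⁺ u v) ≡ numTriangles G
    codeg⁺-sum = sum₂-cong λ u v → trans
      (*-distribˡ-sum (m u v) (λ w → if between u v w then m v w * m u w else 0))
      (sum-cong-≗ λ w → if-scale (between u v w) (m u v) (m v w * m u w) (sym (*-assoc (m u v) (m v w) (m u w))))

    module _ {u v w : Fin n} (u<v : u Fin.< v) (v<w : v Fin.< w) where

      codeg-≥ : m u v * m v w ≤ codeg u w
      codeg-≥ = ≤-trans
        (≤-reflexive (cong (if_then m u v * m v w else 0) (sym (between-true u<v v<w))))
        (term≤sum (λ v → if between u v w then m u v * m v w else 0) v)

      codeg⁺-≥ : m v w * m u w ≤ codeg⁺ u v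
      codeg⁺-≥ = ≤-trans
        (≤-reflexive (cong (if_then m v w * m u w else 0) (sym (between-true u<v v<w))))
        (term≤sum (λ w → if between u v w then m v w * m u w else 0) w)

    -- Deleting the edge between the smallest and largest vertex of every triangle costs at most one
    -- edge per triangle.
    n²≤numTriangles : HardToCover G → n ^ 2 ≤ numTriangles G
    n²≤numTriangles hard = ≤-trans
      (coveringWeight-bound {G = G} hard {λ u w → m u w * codeg u w} λ u v w u<v v<w uv vw uw →
        inj₂ (inj₂ (≤-trans (≤-reflexive (sym (*-identityʳ (m u w))))
          (*-monoʳ-≤ (m u w) (≤-trans (*-mono-≤ uv vw) (codeg-≥ u<v v<w))))))
      (≤-reflexive codeg-sum)

    module _ (C : ℕ) where

      heavy : (Fin n → Fin n → ℕ) → Fin n → Fin n → ℕ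
      heavy d u v = if does (C ℕ.<? d u v) then m u v else 0

      heavy-large : ∀ d u v → C < d u v → m u v ≤ heavy d u v
      heavy-large d u v C<d =
        ≤-reflexive (cong (if_then m u v else 0) (sym (dec-true (C ℕ.<? d u v) C<d)))

      -- Markov's inequality: edges counted by `heavy` lie on pairs where `d` exceeds `C`.
      heavy-cost : ∀ d → C * (∑[ u < n ] ∑[ v < n ] heavy d u v) ≤ ∑[ u < n ] ∑[ v < n ] (m u v * d u v)
      heavy-cost d = ≤-trans (≤-reflexive (*-distribˡ-sum₂ C (heavy d))) (sum₂-mono-≤ cost)
        where
        by-dec : ∀ {u v} (q : Dec (C < d u v)) → C * (if does q then m u v else 0) ≤ m u v * d u v
        by-dec {u} {v} (yes C<d) = ≤-trans (*-monoˡ-≤ (m u v) (<⇒≤ C<d)) (≤-reflexive (*-comm (d u v) (m u v)))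
        by-dec (no _)    = ≤-trans (≤-reflexive (*-zeroʳ C)) z≤n
        cost : ∀ u v → C * heavy d u v ≤ m u v * d u v
        cost u v = by-dec (C ℕ.<? d u v)

      IsLight : Fin n → Fin n → Set
      IsLight u v = u Fin.< v × 0 < m u v × m u v ≤ C × codeg u v ≤ C

      abstract
        isLight? : ∀ u v → Dec (IsLight u v)
        isLight? u v = (u <? v) ×-dec ((0 ℕ.<? m u v) ×-dec ((m u v ≤? C) ×-dec (codeg u v ≤? C)))

      light : Fin n → Fin n → Bool
      light u v = does (isLight? u v)

      -- For each `x` with a light pair xz, the middle vertices are counted by `codeg x z`, which is
      -- at most `C`; there are n choices of `x`.
      light-few : FewTrianglesTo light (n * C)
      light-few z = sum-≤-const row
        where
        term : ∀ x y (xy : Dec (IsLight x y)) (xz : Dec (IsLight x z)) (yz : Dec (IsLight y z)) →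
               χ (does xy) * (χ (does xz) * χ (does yz)) ≤
               χ (does xz) * (if between x y z then m x y * m y z else 0)
        term x y (no _)  _       _       = z≤n
        term x y (yes _) (no _)  _       = z≤n
        term x y (yes _) (yes _) (no _)  = z≤n
        term x y (yes (x<y , xy , _)) (yes _) (yes (y<z , yz , _)) = ≤-trans (*-mono-≤ xy yz)
          (≤-reflexive (trans (cong (if_then m x y * m y z else 0) (sym (between-true x<y y<z)))
                              (sym (*-identityˡ _))))
        codeg-light : ∀ x (xz : Dec (IsLight x z)) → χ (does xz) * codeg x z ≤ C
        codeg-light x (yes (_ , _ , _ , codeg≤C)) = ≤-trans (≤-reflexive (*-identityˡ _)) codeg≤C
        codeg-light x (no _) = z≤n
        row : ∀ x → ∑[ y < n ] (χ (light x y) * (χ (light x z) * χ (light y z))) ≤ C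
        row x = ≤-trans
          (sum-mono-≤ λ y → term x y (isLight? x y) (isLight? x z) (isLight? y z))
          (≤-trans (≤-reflexive (sym (*-distribˡ-sum (χ (light x z))
                      (λ y → if between x y z then m x y * m y z else 0))))
                   (codeg-light x (isLight? x z)))

      -- In a triangle without heavy pairs the products of multiplicities uv·vw and vw·uw are at
      -- most `C`. All factors are positive, so each multiplicity is at most `C`; the three pairs
      -- are light, and `C` times a positive `ω` pays for deleting one.
      light-weight : ∀ (ω : Fin n → Fin n → ℕ) →
        (∀ x y z → light x y ≡ true → light y z ≡ true → light x z ≡ true →
          0 < ω x y ⊎ 0 < ω y z ⊎ 0 < ω x z) →
        CoveringWeight G (λ u v → heavy codeg u v + heavy codeg⁺ u v + C * ω u v)
      light-weight ω covers u v w u<v v<w uv vw uw =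
        by-cases (C ℕ.<? codeg u v) (C ℕ.<? codeg v w) (C ℕ.<? codeg u w) (C ℕ.<? codeg⁺ u v)
        where
        Ω : Fin n → Fin n → ℕ
        Ω u v = heavy codeg u v + heavy codeg⁺ u v + C * ω u v
        Goal : Set
        Goal = m u v ≤ Ω u v ⊎ m v w ≤ Ω v w ⊎ m u w ≤ Ω u w
        heavy₁ : ∀ u v → C < codeg u v → m u v ≤ Ω u v
        heavy₁ u v C<d = ≤-trans (heavy-large codeg u v C<d) (≤-trans (m≤m+n _ _) (m≤m+n _ _))
        heavy₂ : ∀ u v → C < codeg⁺ u v → m u v ≤ Ω u v
        heavy₂ u v C<d = ≤-trans (heavy-large codeg⁺ u v C<d)
          (≤-trans (m≤n+m _ (heavy codeg u v)) (m≤m+n _ _))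
        weighted : ∀ u v → m u v ≤ C → 0 < ω u v → m u v ≤ Ω u v
        weighted u v m≤C ω>0 = ≤-trans m≤C (≤-trans (≤-reflexive (sym (*-identityʳ C)))
          (≤-trans (*-monoʳ-≤ C ω>0) (m≤n+m _ _)))
        factorˡ : ∀ {a b} → 0 < b → a * b ≤ C → a ≤ C
        factorˡ {a} b>0 ab≤C =
          ≤-trans (≤-trans (≤-reflexive (sym (*-identityʳ a))) (*-monoʳ-≤ a b>0)) ab≤C
        factorʳ : ∀ {a b} → 0 < a → a * b ≤ C → b ≤ C
        factorʳ {a} {b} a>0 ab≤C = factorˡ a>0 (≤-trans (≤-reflexive (*-comm b a)) ab≤C)
        is-light : ∀ u v → u Fin.< v → 0 < m u v → m u v ≤ C → ¬ C < codeg u v → light u v ≡ true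
        is-light u v u<v m>0 m≤C C≮d = dec-true (isLight? u v) (u<v , m>0 , m≤C , ≮⇒≥ C≮d)
        by-cases : Dec (C < codeg u v) → Dec (C < codeg v w) → Dec (C < codeg u w) →
                   Dec (C < codeg⁺ u v) → Goal
        by-cases (yes h) _ _ _ = inj₁ (heavy₁ u v h)
        by-cases (no _) (yes h) _ _ = inj₂ (inj₁ (heavy₁ v w h))
        by-cases (no _) (no _) (yes h) _ = inj₂ (inj₂ (heavy₁ u w h))
        by-cases (no _) (no _) (no _) (yes h) = inj₁ (heavy₂ u v h)
        by-cases (no l₁) (no l₂) (no l₃) (no l₄) = from-ω
          (covers u v w (is-light u v u<v uv uv≤C l₁) (is-light v w v<w vw vw≤C l₂)
                        (is-light u w (Finₚ.<-trans u<v v<w) uw uw≤C l₃))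
          where
          uv·vw≤C = ≤-trans (codeg-≥ u<v v<w) (≮⇒≥ l₃)
          uv≤C = factorˡ vw uv·vw≤C
          vw≤C = factorʳ uv uv·vw≤C
          uw≤C = factorʳ vw (≤-trans (codeg⁺-≥ u<v v<w) (≮⇒≥ l₄))
          from-ω : 0 < ω u v ⊎ 0 < ω v w ⊎ 0 < ω u w → Goal
          from-ω (inj₁ p)        = inj₁ (weighted u v uv≤C p)
          from-ω (inj₂ (inj₁ p)) = inj₂ (inj₁ (weighted v w vw≤C p))
          from-ω (inj₂ (inj₂ p)) = inj₂ (inj₂ (weighted u w uw≤C p))

    -- With C = 4K each of the two heavy parts costs at most n²/4, so at least n²/2 must come from
    -- `C` times the weight `ω`.
    light-robust : ∀ K .{{_ : NonZero K}} → HardToCover G → numTriangles G ≤ K * n ^ 2 →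
                   RobustTriangles (light (4 * K)) (2 * (4 * K))
    light-robust K hard T≤K ω covers = *-cancelˡ-≤ 2 (+-cancelˡ-≤ (N + N) _ _ (begin
        N + N + 2 * N                          ≡⟨ e₁ N ⟩
        4 * N                                  ≤⟨ *-monoʳ-≤ 4 (coveringWeight-bound {G = G} hard (light-weight C ω covers)) ⟩
        4 * (∑[ u < n ] ∑[ v < n ] (heavy C codeg u v + heavy C codeg⁺ u v + C * ω u v))
          ≡⟨ cong (4 *_) (trans (sum₂-distrib-+ (λ u v → heavy C codeg u v + heavy C codeg⁺ u v) (λ u v → C * ω u v))
               (cong₂ _+_ (sum₂-distrib-+ (heavy C codeg) (heavy C codeg⁺)) (sym (*-distribˡ-sum₂ C ω)))) ⟩
        4 * (h₁ + h₂ + C * Ω)                  ≡⟨ e₂ h₁ h₂ C Ω ⟩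
        4 * h₁ + 4 * h₂ + 2 * (2 * C * Ω)      ≤⟨ +-monoˡ-≤ _ (+-mono-≤ (small codeg codeg-sum) (small codeg⁺ codeg⁺-sum)) ⟩
        N + N + 2 * (2 * C * Ω)                ∎))
      where
      open ≤-Reasoning
      C = 4 * K
      N = n ^ 2
      h₁ = ∑[ u < n ] ∑[ v < n ] heavy C codeg u v
      h₂ = ∑[ u < n ] ∑[ v < n ] heavy C codeg⁺ u v
      Ω  = ∑[ u < n ] ∑[ v < n ] ω u v
      e₁ : ∀ N → N + N + 2 * N ≡ 4 * N
      e₁ = solve-∀
      e₂ : ∀ a b C w → 4 * (a + b + C * w) ≡ 4 * a + 4 * b + 2 * (2 * C * w)
      e₂ = solve-∀
      e₃ : ∀ K h → K * (4 * h) ≡ 4 * K * h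
      e₃ = solve-∀
      small : ∀ d → ∑[ u < n ] ∑[ v < n ] (m u v * d u v) ≡ numTriangles G →
              4 * (∑[ u < n ] ∑[ v < n ] heavy C d u v) ≤ N
      small d sum-d = *-cancelˡ-≤ K (begin
        K * (4 * (∑[ u < n ] ∑[ v < n ] heavy C d u v))  ≡⟨ e₃ K _ ⟩
        C * (∑[ u < n ] ∑[ v < n ] heavy C d u v)        ≤⟨ heavy-cost C d ⟩
        ∑[ u < n ] ∑[ v < n ] (m u v * d u v)            ≡⟨ sum-d ⟩
        numTriangles G                                   ≤⟨ T≤K ⟩
        K * N                                            ∎)

  threshold : ℕ → ℕ
  threshold K = removal-threshold (2 * (4 * K)) (4 * K)

  many-triangles : ∀ K .{{_ : NonZero K}} {n} → 0 < n → threshold K ≤ n → (G : MultiGraph n) →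
                   HardToCover G → K * n ^ 2 ≤ numTriangles G
  many-triangles K {n} n>0 large G hard with ≤-total (K * n ^ 2) (numTriangles G)
  ... | inj₁ K≤T = K≤T
  ... | inj₂ T≤K = contradiction (light-few (4 * K))
    (no-robust (2 * (4 * K)) (4 * K) n>0 large (light (4 * K)) (light-robust K hard T≤K))
    where open Light G

-- The growth function and its rational values

open import Data.Integer.Base as ℤ using (+_; -[1+_]; ∣_∣)
import Data.Integer.Properties as ℤ
open import Data.Nat.Base using (_⊔_; s≤s⁻¹; z<s)
  renaming (_≤_ to _≤ℕ_; _<_ to _<ℕ_; _*_ to _*ℕ_)
import Data.Nat.Properties as ℕ
open import Data.Nat.Coprimality using (1-coprimeTo) renaming (sym to coprime-sym)
open import Data.Rational.Base as ℚ using (ℚ; 0ℚ; _<_; _≤_; _*_; mkℚ; *≤*; *<*)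
import Data.Rational.Properties as ℚ

open Counting using (HardToCover; threshold; many-triangles; module Light)

-- The division normalises by a gcd that does not compute for a variable `k`; the explicit fraction
-- exposes numerator and denominator.
fromℕ-mkℚ : ∀ k → fromℕ k ≡ mkℚ (+ k) 0 (coprime-sym (1-coprimeTo k))
fromℕ-mkℚ k = ℚ.normalize-coprime (coprime-sym (1-coprimeTo k))

fromℕ-mono-≤ : ∀ {a b} → a ≤ℕ b → fromℕ a ≤ fromℕ b
fromℕ-mono-≤ {a} {b} a≤b rewrite fromℕ-mkℚ a | fromℕ-mkℚ b =
  *≤* (ℤ.*-monoʳ-≤-nonNeg (+ 1) (ℤ.+≤+ a≤b))

fromℕ-positive : ∀ {k} → 0 <ℕ k → 0ℚ < fromℕ k
fromℕ-positive {suc k} _ rewrite fromℕ-mkℚ (suc k) = *<* (ℤ.+<+ z<s)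

fromℕ-* : ∀ a b → fromℕ a * fromℕ b ≡ fromℕ (a *ℕ b)
fromℕ-* a b rewrite fromℕ-mkℚ a | fromℕ-mkℚ b = cong (ℚ._/ 1) (sym (ℤ.pos-* a b))

∣numerator∣-bound : ∀ p → p ≤ fromℕ ∣ ℚ.numerator p ∣
∣numerator∣-bound p@(mkℚ num d _) rewrite fromℕ-mkℚ ∣ num ∣ = *≤* (bound num)
  where
  bound : ∀ i → i ℤ.* + 1 ℤ.≤ + ∣ i ∣ ℤ.* + suc d
  bound (+ k)    = subst₂ ℤ._≤_ (ℤ.pos-* k 1) (ℤ.pos-* k (suc d))
                     (ℤ.+≤+ (ℕ.*-monoʳ-≤ k (ℕ.m≤m+n 1 d)))
  bound -[1+ k ] = ℤ.-≤+

-- The largest K ≤ b with f K ≤ n, or 0 if there is none.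
largestBelow : (ℕ → ℕ) → ℕ → ℕ → ℕ
largestBelow f n zero = zero
largestBelow f n (suc b) with f (suc b) ℕ.≤? n
... | yes _ = suc b
... | no _  = largestBelow f n b

-- A nonzero result was found by the search; the default 0 carries no information about `f 0`.
largestBelow-attains : ∀ f n b → .{{NonZero (largestBelow f n b)}} → f (largestBelow f n b) ≤ℕ n
largestBelow-attains f n (suc b) with f (suc b) ℕ.≤? n
... | yes f≤n = f≤n
... | no _    = largestBelow-attains f n b

largestBelow-max : ∀ f n b {K} → K ≤ℕ b → f K ≤ℕ n → K ≤ℕ largestBelow f n b
largestBelow-max f n zero    K≤0 _ = K≤0
largestBelow-max f n (suc b) {K} K≤b fK≤n with f (suc b) ℕ.≤? n
... | yes _  = K≤b
... | no f≰n with K ℕ.≟ suc b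
...   | yes refl = contradiction fK≤n f≰n
...   | no K≢b   = largestBelow-max f n b (s≤s⁻¹ (ℕ.≤∧≢⇒< K≤b K≢b)) fK≤n

-- The cap n keeps the search finite and still tends to infinity.
level : ℕ → ℕ
level n = largestBelow threshold n n

theorem4 : Σ[ g ∈ (ℕ → ℚ) ]
    (∀ n → 0ℚ < g n) ×
    TendsToInfinity g ×
    (∀ (n : ℕ) .{{_ : NonZero n}} (G : MultiGraph n) →
    (∀ (S : EdgeSet G) → RemovalMakesTriangleFree G S → n ^ 2 ≤ℕ size S) →
    g n * fromℕ (n ^ 2) ≤ fromℕ (numTriangles G))
theorem4 = (λ n → fromℕ (growth n)) , positive , unbounded , bound
  where
  growth : ℕ → ℕ
  -- The maximum with 1 keeps the function positive where no threshold has been reached.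
  growth n = 1 ⊔ level n
  positive : ∀ n → 0ℚ < fromℕ (growth n)
  positive n = fromℕ-positive (ℕ.m≤m⊔n 1 (level n))
  unbounded : TendsToInfinity (λ n → fromℕ (growth n))
  -- Both requirements of `largestBelow-max` are met: `K` is under the cap and its threshold is
  -- reached.
  unbounded q = let K = ∣ ℚ.numerator q ∣ in K ⊔ threshold K , λ n N≤n →
    ℚ.≤-trans (∣numerator∣-bound q) (fromℕ-mono-≤
      (ℕ.≤-trans (largestBelow-max threshold n n (ℕ.m⊔n≤o⇒m≤o K (threshold K) N≤n)
                                                 (ℕ.m⊔n≤o⇒n≤o K (threshold K) N≤n))
                 (ℕ.m≤n⊔m 1 (level n))))
  growth-bound : ∀ n → 0 <ℕ n → (G : MultiGraph n) → HardToCover G →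
                 ∀ h → level n ≡ h → (1 ⊔ h) *ℕ n ^ 2 ≤ℕ numTriangles G
  -- At level 0 the factor is 1, and the elementary bound by n² suffices.
  growth-bound n n>0 G hard zero _ =
    ℕ.≤-trans (ℕ.≤-reflexive (ℕ.*-identityˡ (n ^ 2))) (Light.n²≤numTriangles G hard)
  growth-bound n n>0 G hard (suc h) eq = many-triangles (suc h) n>0
    (subst (λ K → .{{NonZero K}} → threshold K ≤ℕ n) eq (largestBelow-attains threshold n n)) G hard
  bound : ∀ n .{{_ : NonZero n}} (G : MultiGraph n) → HardToCover G →
          fromℕ (growth n) * fromℕ (n ^ 2) ≤ fromℕ (numTriangles G)
  bound n@(suc _) G hard = ℚ.≤-trans (ℚ.≤-reflexive (fromℕ-* (growth n) (n ^ 2)))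
    (fromℕ-mono-≤ (growth-bound n z<s G hard (level n) refl))
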